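{- Let $S$ be a numerical semigroup of maximal embedding dimension generated by an arithmetic sequence, and let $m$ be a positive integer. Then $S=\langle \{a+id: 0\le i\le a-1\}\rangle$ for integers $a\ge1$ and $d\ge1$ with $\gcd(a,d)=1$ (where, if $a=1$, one takes $d=1$). Moreover, $\mathrm{H}(S)$ is equidistributed modulo $m$ if and only if $\gcd(ad,m)=1$ and at least one of the following occurs: (1) $a\equiv1\pmod m$; or (2) $d\equiv-1\pmod m$.
   Context: A numerical semigroup is a submonoid $S$ of $(\mathbb{N}_0,+)$ with finite complement; $\mathrm{H}(S)=\mathbb{N}_0\setminus S$ is its set of gaps. For $G\subset\mathbb{N}_0$, $\langle G\rangle$ is the set of all finite $\mathbb{N}_0$-linear combinations of elements of $G$. The embedding dimension of $S$ is the cardinality of its unique minimal generating set, the multiplicity of $S$ is its least nonzero element, and $S$ has maximal embedding dimension if these two numbers are equal. "Generated by an arithmetic sequence" means that the minimal generating set is of the form $\{a,a+d,a+2d,\dots,a+kd\}$ with $d\ge1$. A finite (multi)set of integers is equidistributed modulo $m$ if it contains the same number of elements in each congruence class modulo $m$. -}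

module Defs where

open import Level using (0ℓ; suc)
open import Data.Nat using (ℕ; _+_; _*_; _∸_; _≤_)
open import Data.Nat.GCD using (gcd)
open import Data.Nat.ListAction using (sum)
open import Data.Integer using (ℤ; +_; _-_)
open import Data.Integer.Divisibility.Signed using (_∣_; _∣?_)
open import Data.List using (List; length; filter; map)
open import Data.List.Membership.Propositional using (_∈_)
open import Data.List.Relation.Unary.All using (All)
open import Data.List.Relation.Unary.Unique.Propositional using (Unique)
open import Data.Product using (_×_; Σ-syntax; ∃-syntax; proj₁; proj₂; uncurry)
open import Relation.Binary.Definitions using (Decidable)
open import Relation.Binary.PropositionalEquality using (_≡_; _≢_)
open import Relation.Unary using (Pred; ∁; _⊆_; _≐_)

_Enumerates_ : List ℕ → Pred ℕ 0ℓ → Set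
xs Enumerates P = Unique xs × P ≐ (_∈ xs)

HasCardinality : Pred ℕ 0ℓ → ℕ → Set
HasCardinality P n = ∃[ xs ] xs Enumerates P × length xs ≡ n

-- The gaps are carried as a duplicate-free list, which is what finiteness of
-- the complement means constructively; the list is unique up to reordering.
record NumericalSemigroup : Set (suc 0ℓ) where
  field
    Carrier         : Pred ℕ 0ℓ
    0-closed        : Carrier 0
    +-closed        : ∀ {x y} → Carrier x → Carrier y → Carrier (x + y)
    gaps            : List ℕ
    gaps-enumerates : gaps Enumerates (∁ Carrier)

open NumericalSemigroup public

-- The list consists of pairs (coefficient , element of G).
⟨_⟩ : Pred ℕ 0ℓ → Pred ℕ 0ℓ
⟨ G ⟩ n = Σ[ cs ∈ List (ℕ × ℕ) ]
  All (λ c → G (proj₂ c)) cs × n ≡ sum (map (uncurry _*_) cs)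

-- Minimality is with respect to inclusion.
IsMinimalGeneratingSet : NumericalSemigroup → Pred ℕ 0ℓ → Set (suc 0ℓ)
IsMinimalGeneratingSet S G =
  Carrier S ≐ ⟨ G ⟩ ×
  ((G′ : Pred ℕ 0ℓ) → G′ ⊆ G → Carrier S ≐ ⟨ G′ ⟩ → G ⊆ G′)

IsEmbeddingDimension : NumericalSemigroup → ℕ → Set (suc 0ℓ)
IsEmbeddingDimension S e =
  ∃[ G ] IsMinimalGeneratingSet S G × HasCardinality G e

IsMultiplicity : NumericalSemigroup → ℕ → Set
IsMultiplicity S n =
  (Carrier S n × n ≢ 0) × (∀ {x} → Carrier S x → x ≢ 0 → n ≤ x)

HasMaximalEmbeddingDimension : NumericalSemigroup → Set (suc 0ℓ)
HasMaximalEmbeddingDimension S =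
  ∃[ n ] IsEmbeddingDimension S n × IsMultiplicity S n

-- { a + i d : 0 ≤ i ≤ k }
ArithmeticSequence : (a d k : ℕ) → Pred ℕ 0ℓ
ArithmeticSequence a d k x = ∃[ i ] i ≤ k × x ≡ a + i * d

IsGeneratedByArithmeticSequence : NumericalSemigroup → Set (suc 0ℓ)
IsGeneratedByArithmeticSequence S =
  ∃[ a ] ∃[ d ] ∃[ k ]
    1 ≤ d × IsMinimalGeneratingSet S (ArithmeticSequence a d k)

-- For a = 1 the set ArithmeticSequence a d (a ∸ 1) does not depend on d; the
-- convention d = 1 then makes a and d uniquely determined by S.
IsPresentedBy : NumericalSemigroup → (a d : ℕ) → Set
IsPresentedBy S a d =
  1 ≤ a × 1 ≤ d × gcd a d ≡ 1 × (a ≡ 1 → d ≡ 1) ×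
  Carrier S ≐ ⟨ ArithmeticSequence a d (a ∸ 1) ⟩

infix 4 _≡_[mod_]

_≡_[mod_] : ℤ → ℤ → ℕ → Set
x ≡ y [mod m ] = + m ∣ x - y

≡[mod_]? : ∀ m → Decidable (_≡_[mod m ])
≡[mod m ]? x y = + m ∣? (x - y)

-- Number of entries of the list xs, viewed as a multiset, in the class of r.
classCount : ℕ → List ℤ → ℤ → ℕ
classCount m xs r = length (filter (λ x → ≡[mod m ]? x r) xs)

Equidistributed : ℕ → List ℤ → Set
Equidistributed m xs = ∀ r s → classCount m xs r ≡ classCount m xs s

{-# OPTIONS --safe #-}

-- A positive x with x − a ∉ S (negative numbers included) is a gap or a nonzero element
-- a + id, 1 ≤ i < a, of the Apéry set of a; it is also a translate by a of a gap or one
-- of 1, …, a − 1.  Modulo m, the numbers c(r) of gaps congruent to r therefore satisfy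
--   c(r − a) + #{1 ≤ i < a : i ≡ r} = c(r) + #{1 ≤ i < a : a + id ≡ r},
-- so when gcd(a, m) = 1 the gaps are equidistributed iff the progressions 1, …, a − 1
-- and a + d, …, a + (a − 1)d agree modulo m.  If a ≡ 1 both are equidistributed, and if
-- d ≡ −1 each is the reverse of the other; the converse comes from telescoping both.
module Submission where

open import Defs
open import Data.Nat
  using (ℕ; zero; suc; _+_; _*_; _∸_; _≤_; _<_; z≤n; s≤s; s≤s⁻¹; _≟_; _≤?_; NonZero; >-nonZero
        ; ≢-nonZero)
open import Data.Nat.Properties
open import Data.Nat.Coprimality as Coprimality
  using (Coprime; coprime-divisor; coprime⇒gcd≡1; gcd≡1⇒coprime; coprime-Bézout; 1-coprimeTo)
open import Data.Nat.Divisibility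
  using (_∣_; divides; ∣-refl; ∣-trans; 1∣_; ∣m∣n⇒∣m+n; ∣m+n∣m⇒∣n; ∣m⇒∣m*n; ∣n⇒∣m*n; ∣1⇒≡1; ∣⇒≤)
open import Data.Nat.GCD using (gcd; gcd[m,n]∣m; gcd[m,n]∣n; module Bézout)
open import Data.Nat.ListAction using (sum)
open import Data.Nat.ListAction.Properties using (sum-++)
open import Data.Nat.Tactic.RingSolver using (solve-∀)
open import Data.Integer as ℤ using (ℤ; +_; 0ℤ; 1ℤ; -1ℤ)
import Data.Integer.Divisibility.Signed as ℤ
open import Data.Integer.DivMod using (_%ℕ_; _/ℕ_; a≡a%ℕn+[a/ℕn]*n)
import Data.Integer.Properties as ℤ
import Data.Integer.Tactic.RingSolver as ℤSolver
open import Data.List using (List; []; _∷_; _∷ʳ_; _++_; applyUpTo; filter; length; map; upTo)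
open import Data.List.Properties
  using (applyUpTo-∷ʳ; filter-++; filter-accept; filter-reject; filter-some; filter-≐; length-++
        ; length-map; length-upTo; map-++; map-id; map-upTo; map-∘)
open import Data.List.Membership.DecPropositional _≟_ using (_∈?_)
open import Data.List.Membership.Propositional using (_∈_; _∉_; lose)
open import Data.List.Membership.Propositional.Properties
  using (∈-++⁺ˡ; ∈-++⁺ʳ; ∈-++⁻; ∈-filter⁺; ∈-filter⁻; ∈-map⁺; ∈-map⁻; ∈-upTo⁺; ∈-upTo⁻; ∈-∃++)
open import Data.List.Membership.Propositional.Properties.WithK using (unique∧set⇒bag)
open import Data.List.Relation.Binary.BagAndSetEquality using (∼bag⇒↭)
open import Data.List.Relation.Binary.Permutation.Propositional using (_↭_)
import Data.List.Relation.Binary.Permutation.Propositional.Properties as ↭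
open import Data.List.Relation.Unary.All as All using (All; []; _∷_)
import Data.List.Relation.Unary.All.Properties as All
open import Data.List.Relation.Unary.AllPairs using ([]; _∷_)
open import Data.List.Relation.Unary.Any using (here; there)
open import Data.List.Relation.Unary.Unique.Propositional using (Unique)
import Data.List.Relation.Unary.Unique.Propositional.Properties as Unique
open import Data.Product using (_×_; _,_; ∃-syntax; proj₁; proj₂; uncurry)
open import Data.Sum as Sum using (_⊎_; inj₁; inj₂)
open import Function using (_∘_)
open import Function.Bundles using (_⇔_; mk⇔)
open import Level using (0ℓ)
open import Algebra.Properties.AbelianGroup ℤ.+-0-abelianGroup using (∙-cancelʳ)
open import Relation.Binary.PropositionalEquality
open import Relation.Nullary using (¬_; yes; no; contradiction)
open import Relation.Nullary.Decidable using (decidable-stable)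
open import Relation.Unary using (Pred; Decidable; _⊆_; _≐_)

-- Finite lists: cardinality and bounds

unique-⊆⇒length≤ : ∀ {A : Set} {xs ys : List A} → Unique xs → (∀ {x} → x ∈ xs → x ∈ ys) →
  length xs ≤ length ys
unique-⊆⇒length≤ [] sub = z≤n
unique-⊆⇒length≤ {xs = x ∷ xs} (x≢ ∷ u) sub with ∈-∃++ (sub (here refl))
... | as , bs , refl = begin
  suc (length xs)               ≤⟨ s≤s (unique-⊆⇒length≤ u sub′) ⟩
  suc (length (as ++ bs))       ≡⟨ cong suc (length-++ as) ⟩
  suc (length as + length bs)   ≡⟨ +-suc (length as) (length bs) ⟨
  length as + length (x ∷ bs)   ≡⟨ length-++ as ⟨
  length (as ++ x ∷ bs)         ∎
  where
  open ≤-Reasoning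
  sub′ : ∀ {y} → y ∈ xs → y ∈ as ++ bs
  sub′ y∈ with ∈-++⁻ as (sub (there y∈))
  ... | inj₁ p            = ∈-++⁺ˡ p
  ... | inj₂ (here refl)  = contradiction refl (All.lookup x≢ y∈)
  ... | inj₂ (there p)    = ∈-++⁺ʳ as p

∈⇒≤sum : ∀ {x xs} → x ∈ xs → x ≤ sum xs
∈⇒≤sum {xs = y ∷ xs} (here refl) = m≤m+n y (sum xs)
∈⇒≤sum {xs = y ∷ xs} (there p)   = m≤n⇒m≤o+n y (∈⇒≤sum p)

-- Generated submonoids

module _ {G : Pred ℕ 0ℓ} where

  0∈⟨⟩ : ⟨ G ⟩ 0
  0∈⟨⟩ = [] , [] , refl

  generator∈⟨⟩ : ∀ {x} → G x → ⟨ G ⟩ x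
  generator∈⟨⟩ {x} Gx = (1 , x) ∷ [] , Gx ∷ [] , sym (trans (+-identityʳ _) (+-identityʳ x))

  +-closed-⟨⟩ : ∀ {x y} → ⟨ G ⟩ x → ⟨ G ⟩ y → ⟨ G ⟩ (x + y)
  +-closed-⟨⟩ (cs , Gcs , refl) (ds , Gds , refl) = cs ++ ds , All.++⁺ Gcs Gds , sym (begin
    sum (map (uncurry _*_) (cs ++ ds))                        ≡⟨ cong sum (map-++ (uncurry _*_) cs ds) ⟩
    sum (map (uncurry _*_) cs ++ map (uncurry _*_) ds)        ≡⟨ sum-++ (map (uncurry _*_) cs) _ ⟩
    sum (map (uncurry _*_) cs) + sum (map (uncurry _*_) ds)   ∎)
    where open ≡-Reasoning

  *-closed-⟨⟩ : ∀ c {x} → ⟨ G ⟩ x → ⟨ G ⟩ (c * x)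
  *-closed-⟨⟩ zero    _  = 0∈⟨⟩
  *-closed-⟨⟩ (suc c) Gx = +-closed-⟨⟩ Gx (*-closed-⟨⟩ c Gx)

⟨⟩-induction : ∀ {G P : Pred ℕ 0ℓ} → P 0 → (∀ c {g y} → G g → P y → P (c * g + y)) → ⟨ G ⟩ ⊆ P
⟨⟩-induction {G} {P} base step (cs , Gcs , refl) = go cs Gcs
  where
  go : ∀ cs → All (G ∘ proj₂) cs → P (sum (map (uncurry _*_) cs))
  go []             []         = base
  go ((c , _) ∷ cs) (Gg ∷ Gcs) = step c Gg (go cs Gcs)

⟨⟩-least : ∀ {G H : Pred ℕ 0ℓ} → G ⊆ ⟨ H ⟩ → ⟨ G ⟩ ⊆ ⟨ H ⟩
⟨⟩-least {H = H} sub = ⟨⟩-induction {P = ⟨ H ⟩} 0∈⟨⟩ λ c Gg Hy → +-closed-⟨⟩ (*-closed-⟨⟩ c (sub Gg)) Hy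

⟨⟩-∣ : ∀ {G : Pred ℕ 0ℓ} {g} → (∀ {x} → G x → g ∣ x) → ∀ {x} → ⟨ G ⟩ x → g ∣ x
⟨⟩-∣ {g = g} g∣G = ⟨⟩-induction {P = g ∣_} (divides 0 refl) λ c Gx g∣y → ∣m∣n⇒∣m+n (∣n⇒∣m*n c (g∣G Gx)) g∣y

-- A generator occurring in `y` with positive coefficient is at most `y`, hence at most `x`. Thus
-- either `x` itself occurs, or every generator that occurs is smaller than `x`.
bounded-generators : ∀ {G : Pred ℕ 0ℓ} x {y} → ⟨ G ⟩ y → y ≤ x → G x ⊎ ⟨ (λ g → G g × g < x) ⟩ y
bounded-generators {G} x =
  ⟨⟩-induction {P = λ y → y ≤ x → G x ⊎ ⟨ (λ g → G g × g < x) ⟩ y} (λ _ → inj₂ 0∈⟨⟩) step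
  where
  step : ∀ c {g y} → G g → (y ≤ x → G x ⊎ ⟨ (λ g → G g × g < x) ⟩ y) →
         c * g + y ≤ x → G x ⊎ ⟨ (λ g → G g × g < x) ⟩ (c * g + y)
  -- A generator with coefficient 0 may exceed `x`; its term is dropped.
  step zero            Gg ih le = ih le
  step (suc c) {g} {y} Gg ih le with m≤n⇒m<n∨m≡n (m+n≤o⇒m≤o g (m+n≤o⇒m≤o (suc c * g) le))
  ... | inj₂ refl = inj₁ Gg
  ... | inj₁ g<x  =
    Sum.map₂ (+-closed-⟨⟩ (*-closed-⟨⟩ (suc c) (generator∈⟨⟩ (Gg , g<x)))) (ih (m+n≤o⇒n≤o (suc c * g) le))

-- An element of G outside H is a sum of strictly smaller elements of H, hence of
-- elements of G other than itself, so it could be dropped from G.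
minimal⊆generating : ∀ S {G H : Pred ℕ 0ℓ} → IsMinimalGeneratingSet S G → Carrier S ≐ ⟨ H ⟩ → G ⊆ H
minimal⊆generating S {G} {H} ((S⊆G , G⊆S) , minimal) (S⊆H , H⊆S) {x} Gx
  with bounded-generators x (S⊆H (G⊆S (generator∈⟨⟩ Gx))) ≤-refl
... | inj₁ Hx = Hx
... | inj₂ x∈ = contradiction refl (proj₂ (minimal G∖x proj₁ (S⊆G∖x , G∖x⊆S) Gx))
  where
  G∖x : Pred ℕ 0ℓ
  G∖x g = G g × g ≢ x

  smaller : (λ h → H h × h < x) ⊆ ⟨ G∖x ⟩
  smaller {h} (Hh , h<x) with bounded-generators h (S⊆G (H⊆S (generator∈⟨⟩ Hh))) ≤-refl
  ... | inj₁ Gh = generator∈⟨⟩ (Gh , <⇒≢ h<x)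
  ... | inj₂ h∈ = ⟨⟩-least (λ (Gg , g<h) → generator∈⟨⟩ (Gg , <⇒≢ (<-trans g<h h<x))) h∈

  G⊆⟨G∖x⟩ : G ⊆ ⟨ G∖x ⟩
  G⊆⟨G∖x⟩ {g} Gg with g ≟ x
  ... | yes refl = ⟨⟩-least smaller x∈
  ... | no  g≢x  = generator∈⟨⟩ (Gg , g≢x)

  S⊆G∖x : Carrier S ⊆ ⟨ G∖x ⟩
  S⊆G∖x = ⟨⟩-least G⊆⟨G∖x⟩ ∘ S⊆G

  G∖x⊆S : ⟨ G∖x ⟩ ⊆ Carrier S
  G∖x⊆S = G⊆S ∘ ⟨⟩-least (generator∈⟨⟩ ∘ proj₁)

-- Removing 0 from `G` leaves the generated submonoid unchanged, and `G` is contained in every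
-- generating set, so in `G` without 0.
minimal∌0 : ∀ S {G : Pred ℕ 0ℓ} → IsMinimalGeneratingSet S G → ¬ G 0
minimal∌0 S {G} min@((S⊆G , G⊆S) , _) G0 =
  proj₂ (minimal⊆generating S {H = G∖0} min (⟨⟩-least nonzero ∘ S⊆G , G⊆S ∘ ⟨⟩-least (generator∈⟨⟩ ∘ proj₁))
    G0) refl
  where
  G∖0 : Pred ℕ 0ℓ
  G∖0 g = G g × g ≢ 0

  nonzero : G ⊆ ⟨ G∖0 ⟩
  nonzero {zero}  _  = 0∈⟨⟩
  nonzero {suc g} Gg = generator∈⟨⟩ (Gg , λ ())

-- Semigroups generated by an arithmetic sequence

arithmeticSequence-enumerates : ∀ a {d} k → 1 ≤ d →
  map (λ i → a + i * d) (upTo (suc k)) Enumerates ArithmeticSequence a d k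
arithmeticSequence-enumerates a {d@(suc _)} k _ =
  Unique.map⁺ (λ {i} {j} → *-cancelʳ-≡ i j d ∘ +-cancelˡ-≡ a _ _) (Unique.upTo⁺ (suc k)) ,
  (λ { (i , i≤k , refl) → ∈-map⁺ _ (∈-upTo⁺ (s≤s i≤k)) }) ,
  (λ x∈ → let (i , i∈ , eq) = ∈-map⁻ _ x∈ in i , s≤s⁻¹ (∈-upTo⁻ i∈) , eq)

module _ {a d k : ℕ} where

  -- Here `c` is the number of generators used, with repetition, and `j` is the sum of their
  -- indices, each at most `k`.
  ⟨arithmeticSequence⟩⇒ : ∀ {x} → ⟨ ArithmeticSequence a d k ⟩ x →
    ∃[ c ] ∃[ j ] j ≤ c * k × x ≡ c * a + j * d
  ⟨arithmeticSequence⟩⇒ = ⟨⟩-induction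
    {P = λ x → ∃[ c ] ∃[ j ] j ≤ c * k × x ≡ c * a + j * d} (0 , 0 , z≤n , refl)
    λ { c (i , i≤k , refl) (c′ , j , j≤ , refl) →
      c + c′ , c * i + j ,
      ≤-trans (+-mono-≤ (*-monoʳ-≤ c i≤k) j≤) (≤-reflexive (sym (*-distribʳ-+ k c c′))) ,
      regroup a d c i c′ j }
    where
    regroup : ∀ a d c i c′ j → c * (a + i * d) + (c′ * a + j * d) ≡ (c + c′) * a + (c * i + j) * d
    regroup = solve-∀

  -- Greedy choice: take the top generator a + kd while the index sum exceeds `k`, then one
  -- generator with the remaining index, and fill up with copies of a.
  ⟨arithmeticSequence⟩⇐ : ∀ c j → j ≤ c * k → ⟨ ArithmeticSequence a d k ⟩ (c * a + j * d)
  ⟨arithmeticSequence⟩⇐ zero    zero _  = 0∈⟨⟩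
  ⟨arithmeticSequence⟩⇐ (suc c) j    j≤ with j ≤? k
  ... | yes j≤k = subst ⟨ ArithmeticSequence a d k ⟩ (regroup a d c j)
          (+-closed-⟨⟩ (generator∈⟨⟩ (j , j≤k , refl))
            (*-closed-⟨⟩ c (generator∈⟨⟩ (0 , z≤n , sym (+-identityʳ a)))))
    where
    regroup : ∀ a d c j → a + j * d + c * a ≡ suc c * a + j * d
    regroup = solve-∀
  ... | no  j≰k = subst ⟨ ArithmeticSequence a d k ⟩ eq
          (+-closed-⟨⟩ (generator∈⟨⟩ (k , ≤-refl , refl))
            (⟨arithmeticSequence⟩⇐ c (j ∸ k) (m≤n+o⇒m∸n≤o j k j≤)))
    where
    regroup : ∀ a d k c l → a + k * d + (c * a + l * d) ≡ suc c * a + (k + l) * d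
    regroup = solve-∀
    eq : a + k * d + (c * a + (j ∸ k) * d) ≡ suc c * a + j * d
    eq = trans (regroup a d k c (j ∸ k)) (cong (λ z → suc c * a + z * d) (m+[n∸m]≡n (≰⇒≥ j≰k)))

a∈⟨arithmeticSequence⟩ : ∀ {a d k} → ⟨ ArithmeticSequence a d k ⟩ a
a∈⟨arithmeticSequence⟩ {a} = generator∈⟨⟩ (0 , z≤n , sym (+-identityʳ a))

⟨arithmeticSequence⟩-≥ : ∀ {a d k x} → ⟨ ArithmeticSequence a d k ⟩ x → x ≢ 0 → a ≤ x
⟨arithmeticSequence⟩-≥ {a} x∈ x≢0 with ⟨arithmeticSequence⟩⇒ x∈
... | zero  , zero , _ , refl = contradiction refl x≢0
... | suc c , j    , _ , refl = ≤-trans (m≤m+n a (c * a)) (m≤m+n (suc c * a) _)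

-- The gap list describes the complement of `Carrier S`, whose membership need not be decidable, so
-- only a double negation results. It is eliminated where the goal is decidable.
∉gaps⇒¬¬∈ : ∀ S {x} → x ∉ gaps S → ¬ ¬ Carrier S x
∉gaps⇒¬¬∈ S x∉gaps x∉S = x∉gaps (proj₁ (proj₂ (gaps-enumerates S)) x∉S)

-- Two consecutive numbers beyond all gaps lie in S, and gcd(a, d) divides both, hence their
-- difference 1.
semigroup-gcd≡1 : ∀ S {a d k} → Carrier S ≐ ⟨ ArithmeticSequence a d k ⟩ → gcd a d ≡ 1
semigroup-gcd≡1 S {a} {d} (S⊆A , _) = decidable-stable (gcd a d ≟ 1) λ gcd≢1 →
  large N ≤-refl λ N∈S → large (suc N) (n≤1+n N) λ 1+N∈S →
  gcd≢1 (∣1⇒≡1 (∣m+n∣m⇒∣n (subst (gcd a d ∣_) (+-comm 1 N) (gcd∣S 1+N∈S)) (gcd∣S N∈S)))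
  where
  -- Each gap is at most the sum of all gaps, so no number from `N` on is a gap.
  N = suc (sum (gaps S))

  large : ∀ x → N ≤ x → ¬ ¬ Carrier S x
  large x N≤x = ∉gaps⇒¬¬∈ S λ x∈ → <⇒≱ N≤x (∈⇒≤sum x∈)

  gcd∣S : ∀ {x} → Carrier S x → gcd a d ∣ x
  gcd∣S = ⟨⟩-∣ (λ { (i , _ , refl) → ∣m∣n⇒∣m+n (gcd[m,n]∣m a d) (∣n⇒∣m*n i (gcd[m,n]∣n a d)) }) ∘ S⊆A

-- The multiplicity is a, the least nonzero element. Two minimal generating sets contain each other,
-- so the embedding dimension is k + 1; equating the two gives k = a - 1.
presentation-exists : ∀ S → HasMaximalEmbeddingDimension S → IsGeneratedByArithmeticSequence S →
  ∃[ a ] ∃[ d ] IsPresentedBy S a d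
presentation-exists S _ (zero , d , k , _ , minA) = contradiction (0 , z≤n , refl) (minimal∌0 S minA)
presentation-exists S (n , (G , minG , xs , (uniq-xs , G⊆xs , xs⊆G) , |xs|≡n) , (n∈S , n≢0) , n-least)
                      (a@(suc a-1) , d , k , 1≤d , minA@(S≐A@(S⊆A , A⊆S) , _)) = present a-1 k≡a-1 S≐A
  where
  A-list : List ℕ
  A-list = map (λ i → a + i * d) (upTo (suc k))

  n≡a : n ≡ a
  n≡a = ≤-antisym (n-least (A⊆S a∈⟨arithmeticSequence⟩) λ ()) (⟨arithmeticSequence⟩-≥ (S⊆A n∈S) n≢0)

  A-enum : A-list Enumerates ArithmeticSequence a d k
  A-enum = arithmeticSequence-enumerates a k 1≤d

  n≡1+k : n ≡ suc k
  n≡1+k = begin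
    n                  ≡⟨ |xs|≡n ⟨
    length xs
      ≡⟨ ≤-antisym (unique-⊆⇒length≤ uniq-xs (proj₁ (proj₂ A-enum) ∘ minimal⊆generating S minG S≐A ∘ xs⊆G))
                   (unique-⊆⇒length≤ (proj₁ A-enum)
                     (G⊆xs ∘ minimal⊆generating S minA (proj₁ minG) ∘ proj₂ (proj₂ A-enum))) ⟩
    length A-list      ≡⟨ length-map _ (upTo (suc k)) ⟩
    length (upTo (suc k)) ≡⟨ length-upTo (suc k) ⟩
    suc k              ∎
    where open ≡-Reasoning

  k≡a-1 : k ≡ a-1
  k≡a-1 = suc-injective (trans (sym n≡1+k) n≡a)

  present : ∀ a-1 → k ≡ a-1 → Carrier S ≐ ⟨ ArithmeticSequence (suc a-1) d k ⟩ →
    ∃[ a ] ∃[ d ] IsPresentedBy S a d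
  -- For a = 1 the sequence is {1} whatever its difference, which is replaced by the conventional 1.
  present zero refl (S⊆A , A⊆S) = 1 , 1 , ≤-refl , ≤-refl , refl , (λ _ → refl) ,
    ⟨⟩-least (λ { (_ , z≤n , refl) → generator∈⟨⟩ (0 , z≤n , refl) }) ∘ S⊆A ,
    A⊆S ∘ ⟨⟩-least (λ { (_ , z≤n , refl) → generator∈⟨⟩ (0 , z≤n , refl) })
  present (suc b) refl S≐A = suc (suc b) , d , s≤s z≤n , 1≤d , semigroup-gcd≡1 S S≐A , (λ ()) , S≐A

-- Congruences

module _ {m : ℕ} where

  mod-refl : ∀ x → x ≡ x [mod m ]
  mod-refl x = subst (+ m ℤ.∣_) (sym (ℤ.+-inverseʳ x)) (ℤ.divides 0ℤ refl)

  mod-sym : ∀ x y → x ≡ y [mod m ] → y ≡ x [mod m ]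
  mod-sym x y p = subst (+ m ℤ.∣_) (eq x y) (ℤ.∣m⇒∣-m p)
    where
    eq : ∀ x y → ℤ.- (x ℤ.- y) ≡ y ℤ.- x
    eq = ℤSolver.solve-∀

  mod-trans : ∀ x y z → x ≡ y [mod m ] → y ≡ z [mod m ] → x ≡ z [mod m ]
  mod-trans x y z p q = subst (+ m ℤ.∣_) (eq x y z) (ℤ.∣m∣n⇒∣m+n p q)
    where
    eq : ∀ x y z → (x ℤ.- y) ℤ.+ (y ℤ.- z) ≡ x ℤ.- z
    eq = ℤSolver.solve-∀

  ∣-resp : ∀ {x y} → x ≡ y → + m ℤ.∣ x → + m ℤ.∣ y
  ∣-resp = subst (+ m ℤ.∣_)

  -- Bézout gives an inverse e of a modulo m, and ze is the required multiplier. It is reduced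
  -- modulo m to a natural number, so that a translation by a can be iterated that many times.
  coprime⇒multiple : .{{_ : NonZero m}} → ∀ {a} → Coprime a m → ∀ z → ∃[ t ] + t ℤ.* + a ≡ z [mod m ]
  coprime⇒multiple {a} cop z = inverse⇒multiple (inverse (coprime-Bézout cop))
    where
    inverse : Bézout.Identity 1 a m → ∃[ e ] e ℤ.* + a ≡ 1ℤ [mod m ]
    inverse (Bézout.+- x y eq) = + x , ℤ.divides (+ y) (begin
      + x ℤ.* + a ℤ.- 1ℤ             ≡⟨ cong (ℤ._- 1ℤ) (ℤ.pos-* x a) ⟨
      + (x * a) ℤ.- 1ℤ               ≡⟨ cong (λ k → + k ℤ.- 1ℤ) eq ⟨
      + (1 + y * m) ℤ.- 1ℤ           ≡⟨ cong (λ k → (1ℤ ℤ.+ k) ℤ.- 1ℤ) (ℤ.pos-* y m) ⟩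
      (1ℤ ℤ.+ + y ℤ.* + m) ℤ.- 1ℤ    ≡⟨ solve (+ y) (+ m) ⟩
      + y ℤ.* + m                    ∎)
      where
      open ≡-Reasoning
      solve : ∀ y m → (1ℤ ℤ.+ y ℤ.* m) ℤ.- 1ℤ ≡ y ℤ.* m
      solve = ℤSolver.solve-∀
    inverse (Bézout.-+ x y eq) = ℤ.- + x , ℤ.divides (ℤ.- + y) (begin
      ℤ.- + x ℤ.* + a ℤ.- 1ℤ         ≡⟨ solve (+ x) (+ a) ⟩
      ℤ.- (1ℤ ℤ.+ + x ℤ.* + a)       ≡⟨ cong (λ k → ℤ.- (1ℤ ℤ.+ k)) (ℤ.pos-* x a) ⟨
      ℤ.- + (1 + x * a)              ≡⟨ cong (λ k → ℤ.- + k) eq ⟩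
      ℤ.- + (y * m)                  ≡⟨ cong ℤ.-_ (ℤ.pos-* y m) ⟩
      ℤ.- (+ y ℤ.* + m)              ≡⟨ ℤ.neg-distribˡ-* (+ y) (+ m) ⟩
      ℤ.- + y ℤ.* + m                ∎)
      where
      open ≡-Reasoning
      solve : ∀ x a → ℤ.- x ℤ.* a ℤ.- 1ℤ ≡ ℤ.- (1ℤ ℤ.+ x ℤ.* a)
      solve = ℤSolver.solve-∀

    inverse⇒multiple : ∃[ e ] e ℤ.* + a ≡ 1ℤ [mod m ] → ∃[ t ] + t ℤ.* + a ≡ z [mod m ]
    inverse⇒multiple (e , ℤ.divides q eq) = t , ℤ.divides (z ℤ.* q ℤ.- k ℤ.* + a) (begin
      + t ℤ.* + a ℤ.- z                                       ≡⟨ solve₁ (+ t) k (+ m) (+ a) z ⟩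
      (+ t ℤ.+ k ℤ.* + m) ℤ.* + a ℤ.- z ℤ.- k ℤ.* + a ℤ.* + m
        ≡⟨ cong (λ s → s ℤ.* + a ℤ.- z ℤ.- k ℤ.* + a ℤ.* + m) (a≡a%ℕn+[a/ℕn]*n (z ℤ.* e) m) ⟨
      z ℤ.* e ℤ.* + a ℤ.- z ℤ.- k ℤ.* + a ℤ.* + m             ≡⟨ solve₂ z e k (+ a) (+ m) ⟩
      z ℤ.* (e ℤ.* + a ℤ.- 1ℤ) ℤ.- k ℤ.* + a ℤ.* + m
        ≡⟨ cong (λ s → z ℤ.* s ℤ.- k ℤ.* + a ℤ.* + m) eq ⟩
      z ℤ.* (q ℤ.* + m) ℤ.- k ℤ.* + a ℤ.* + m                 ≡⟨ solve₃ z q k (+ a) (+ m) ⟩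
      (z ℤ.* q ℤ.- k ℤ.* + a) ℤ.* + m                         ∎)
      where
      open ≡-Reasoning
      t = (z ℤ.* e) %ℕ m
      k = (z ℤ.* e) /ℕ m
      solve₁ : ∀ t k m a z → t ℤ.* a ℤ.- z ≡ (t ℤ.+ k ℤ.* m) ℤ.* a ℤ.- z ℤ.- k ℤ.* a ℤ.* m
      solve₁ = ℤSolver.solve-∀
      solve₂ : ∀ z e k a m → z ℤ.* e ℤ.* a ℤ.- z ℤ.- k ℤ.* a ℤ.* m ≡
        z ℤ.* (e ℤ.* a ℤ.- 1ℤ) ℤ.- k ℤ.* a ℤ.* m
      solve₂ = ℤSolver.solve-∀
      solve₃ : ∀ z q k a m → z ℤ.* (q ℤ.* m) ℤ.- k ℤ.* a ℤ.* m ≡ (z ℤ.* q ℤ.- k ℤ.* a) ℤ.* m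
      solve₃ = ℤSolver.solve-∀

-- Counting in residue classes

length-filter-map-cong : ∀ {A B : Set} {P Q : Pred B 0ℓ} (P? : Decidable P) (Q? : Decidable Q)
  {f g : A → B} →
  (∀ x → P (f x) → Q (g x)) → (∀ x → Q (g x) → P (f x)) →
  ∀ xs → length (filter P? (map f xs)) ≡ length (filter Q? (map g xs))
length-filter-map-cong P? Q? P⇒Q Q⇒P [] = refl
length-filter-map-cong P? Q? {f} P⇒Q Q⇒P (x ∷ xs) with P? (f x)
... | yes p =
  trans (cong suc (length-filter-map-cong P? Q? P⇒Q Q⇒P xs))
    (sym (cong length (filter-accept Q? (P⇒Q x p))))
... | no ¬p =
  trans (length-filter-map-cong P? Q? P⇒Q Q⇒P xs) (sym (cong length (filter-reject Q? (¬p ∘ Q⇒P x))))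

count : ℕ → List ℕ → ℤ → ℕ
count m xs r = classCount m (map +_ xs) r

module _ {m : ℕ} where

  classCount-++ : ∀ xs ys r → classCount m (xs ++ ys) r ≡ classCount m xs r + classCount m ys r
  classCount-++ xs ys r =
    trans (cong length (filter-++ (λ x → ≡[mod m ]? x r) xs ys))
      (length-++ (filter (λ x → ≡[mod m ]? x r) xs))

  count-++ : ∀ xs ys r → count m (xs ++ ys) r ≡ count m xs r + count m ys r
  count-++ xs ys r =
    trans (cong (λ zs → classCount m zs r) (map-++ +_ xs ys)) (classCount-++ (map +_ xs) (map +_ ys) r)

  count-↭ : ∀ {xs ys} → xs ↭ ys → ∀ r → count m xs r ≡ count m ys r
  count-↭ xs↭ys r = ↭.↭-length (↭.filter-↭ (λ x → ≡[mod m ]? x r) (↭.map⁺ +_ xs↭ys))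

  count-map-cong : ∀ {f g : ℕ → ℕ} {r s} →
    (∀ x → + f x ≡ r [mod m ] → + g x ≡ s [mod m ]) → (∀ x → + g x ≡ s [mod m ] → + f x ≡ r [mod m ]) →
    ∀ xs → count m (map f xs) r ≡ count m (map g xs) s
  count-map-cong {f} {g} {r} {s} f⇒g g⇒f xs = begin
    length (filter (λ x → ≡[mod m ]? x r) (map +_ (map f xs)))
      ≡⟨ cong (length ∘ filter (λ x → ≡[mod m ]? x r)) (map-∘ xs) ⟨
    length (filter (λ x → ≡[mod m ]? x r) (map (+_ ∘ f) xs))
      ≡⟨ length-filter-map-cong (λ x → ≡[mod m ]? x r) (λ x → ≡[mod m ]? x s) f⇒g g⇒f xs ⟩
    length (filter (λ x → ≡[mod m ]? x s) (map (+_ ∘ g) xs))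
      ≡⟨ cong (length ∘ filter (λ x → ≡[mod m ]? x s)) (map-∘ xs) ⟩
    length (filter (λ x → ≡[mod m ]? x s) (map +_ (map g xs)))  ∎
    where open ≡-Reasoning

  count-map-shift : ∀ {f g : ℕ → ℕ} {r s} → (∀ x → + f x ℤ.- r ≡ + g x ℤ.- s) →
    ∀ xs → count m (map f xs) r ≡ count m (map g xs) s
  count-map-shift eq = count-map-cong (λ x → ∣-resp (eq x)) (λ x → ∣-resp (sym (eq x)))

  classCount-resp : ∀ xs {r s} → r ≡ s [mod m ] → classCount m xs r ≡ classCount m xs s
  classCount-resp xs {r} {s} r≡s = cong length (filter-≐ (λ x → ≡[mod m ]? x r) (λ x → ≡[mod m ]? x s)
    ((λ {x} x≡r → mod-trans x r s x≡r r≡s) , (λ {x} x≡s → mod-trans x s r x≡s (mod-sym r s r≡s))) xs)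

  count-singleton-yes : ∀ {x r} → + x ≡ r [mod m ] → count m (x ∷ []) r ≡ 1
  count-singleton-yes {x} {r} p = cong length (filter-accept (λ x → ≡[mod m ]? x r) p)

  count-singleton-no : ∀ {x r} → ¬ + x ≡ r [mod m ] → count m (x ∷ []) r ≡ 0
  count-singleton-no {x} {r} ¬p = cong length (filter-reject (λ x → ≡[mod m ]? x r) ¬p)

  -- Both sides count h 0, ..., h n, split off at the first term or at the last.
  count-upTo-suc : ∀ (h : ℕ → ℕ) n r →
    count m (h 0 ∷ []) r + count m (map (h ∘ suc) (upTo n)) r ≡
    count m (map h (upTo n)) r + count m (h n ∷ []) r
  count-upTo-suc h n r = begin
    count m (h 0 ∷ []) r + count m (map (h ∘ suc) (upTo n)) r  ≡⟨ count-++ (h 0 ∷ []) _ r ⟨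
    count m (h 0 ∷ map (h ∘ suc) (upTo n)) r
      ≡⟨ cong (λ xs → count m (h 0 ∷ xs) r) (map-upTo (h ∘ suc) n) ⟩
    count m (applyUpTo h (suc n)) r
      ≡⟨ cong (λ xs → count m xs r) (applyUpTo-∷ʳ h n) ⟨
    count m (applyUpTo h n ∷ʳ h n) r
      ≡⟨ cong (λ xs → count m (xs ∷ʳ h n) r) (map-upTo h n) ⟨
    count m (map h (upTo n) ∷ʳ h n) r                          ≡⟨ count-++ (map h (upTo n)) _ r ⟩
    count m (map h (upTo n)) r + count m (h n ∷ []) r          ∎
    where open ≡-Reasoning

  -- Telescoping: h i lies in the class of r - e exactly when h (i + 1) lies in the class of r.
  count-progression : ∀ (h : ℕ → ℕ) e → (∀ i → h (suc i) ≡ h i + e) → ∀ n r →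
    count m (h 0 ∷ []) r + count m (map h (upTo n)) (r ℤ.- + e) ≡
    count m (map h (upTo n)) r + count m (h n ∷ []) r
  count-progression h e step n r = trans
    (cong₂ _+_ refl (count-map-shift shift (upTo n)))
    (count-upTo-suc h n r)
    where
    solve : ∀ x e r → x ℤ.- (r ℤ.- e) ≡ x ℤ.+ e ℤ.- r
    solve = ℤSolver.solve-∀
    shift : ∀ i → + h i ℤ.- (r ℤ.- + e) ≡ + h (suc i) ℤ.- r
    shift i = trans (solve (+ h i) (+ e) r) (cong (λ k → + k ℤ.- r) (sym (step i)))

  -- By hypothesis h i ≡ n - i, so h 0, ..., h (n - 1) run through n, ..., 1. In the induction the
  -- first term h 0 becomes the last term of the interval.
  count-reverse : ∀ (h : ℕ → ℕ) n → (∀ i → + (h i + i) ≡ + n [mod m ]) → ∀ r →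
    count m (map h (upTo n)) r ≡ count m (map suc (upTo n)) r
  count-reverse h zero    h+i≡n r = refl
  count-reverse h (suc n) h+i≡n r = begin
    count m (map h (upTo (suc n))) r
      ≡⟨ cong (λ xs → count m xs r)
           (trans (map-upTo h (suc n)) (cong (h 0 ∷_) (sym (map-upTo (h ∘ suc) n)))) ⟩
    count m (h 0 ∷ map (h ∘ suc) (upTo n)) r                    ≡⟨ count-++ (h 0 ∷ []) _ r ⟩
    count m (h 0 ∷ []) r + count m (map (h ∘ suc) (upTo n)) r   ≡⟨ +-comm (count m (h 0 ∷ []) r) _ ⟩
    count m (map (h ∘ suc) (upTo n)) r + count m (h 0 ∷ []) r
      ≡⟨ cong₂ _+_ (count-reverse (h ∘ suc) n tail r) head ⟩
    count m (map suc (upTo n)) r + count m (suc n ∷ []) r       ≡⟨ count-++ (map suc (upTo n)) _ r ⟨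
    count m (map suc (upTo n) ∷ʳ suc n) r
      ≡⟨ cong (λ xs → count m (xs ∷ʳ suc n) r) (map-upTo suc n) ⟩
    count m (applyUpTo suc n ∷ʳ suc n) r
      ≡⟨ cong (λ xs → count m xs r) (trans (applyUpTo-∷ʳ suc n) (sym (map-upTo suc (suc n)))) ⟩
    count m (map suc (upTo (suc n))) r                          ∎
    where
    open ≡-Reasoning
    h0≡1+n : + h 0 ≡ + suc n [mod m ]
    h0≡1+n = subst (λ k → + k ≡ + suc n [mod m ]) (+-identityʳ (h 0)) (h+i≡n 0)
    head : count m (h 0 ∷ []) r ≡ count m (suc n ∷ []) r
    -- A singleton is treated as the image of a dummy one-element list under a constant function.
    head = count-map-cong {f = λ _ → h 0} {g = λ _ → suc n}
      (λ _ → mod-trans (+ suc n) (+ h 0) r (mod-sym (+ h 0) (+ suc n) h0≡1+n))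
        (λ _ → mod-trans (+ h 0) (+ suc n) r h0≡1+n) (0 ∷ [])
    solve : ∀ h i n → h ℤ.+ (1ℤ ℤ.+ i) ℤ.- (1ℤ ℤ.+ n) ≡ h ℤ.+ i ℤ.- n
    solve = ℤSolver.solve-∀
    tail : ∀ i → + (h (suc i) + i) ≡ + n [mod m ]
    tail i = ∣-resp (solve (+ h (suc i)) (+ i) (+ n)) (h+i≡n (suc i))

  -- Since a generates the residues modulo m, repeated steps of a lead from any class to any other.
  shift-invariant⇒constant : .{{_ : NonZero m}} → ∀ xs {a} → Coprime a m →
    (∀ r → classCount m xs (r ℤ.- + a) ≡ classCount m xs r) → Equidistributed m xs
  shift-invariant⇒constant xs {a} cop shift r s = reach (coprime⇒multiple cop (r ℤ.- s))
    where
    iterate : ∀ t → classCount m xs (r ℤ.- + t ℤ.* + a) ≡ classCount m xs r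
    iterate zero    = cong (classCount m xs) (ℤ.+-identityʳ r)
    iterate (suc t) =
      trans (cong (classCount m xs) (eq r (+ t) (+ a))) (trans (shift (r ℤ.- + t ℤ.* + a)) (iterate t))
      where
      eq : ∀ r t a → r ℤ.- (1ℤ ℤ.+ t) ℤ.* a ≡ r ℤ.- t ℤ.* a ℤ.- a
      eq = ℤSolver.solve-∀
    reach : ∃[ t ] + t ℤ.* + a ≡ r ℤ.- s [mod m ] → classCount m xs r ≡ classCount m xs s
    reach (t , ta≡r-s) = trans (sym (iterate t)) (classCount-resp xs
      (∣-resp (eq r s (+ t ℤ.* + a)) (mod-sym (+ t ℤ.* + a) (r ℤ.- s) ta≡r-s)))
      where
      eq : ∀ r s x → r ℤ.- s ℤ.- x ≡ r ℤ.- x ℤ.- s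
      eq = ℤSolver.solve-∀

module _ {m : ℕ} where

  count-positive⁺ : ∀ {x xs r} → x ∈ xs → + x ≡ r [mod m ] → 0 < count m xs r
  count-positive⁺ {r = r} x∈ x≡r = filter-some (λ x → ≡[mod m ]? x r) (lose (∈-map⁺ +_ x∈) x≡r)

  count-positive⁻ : ∀ xs {r} → 0 < count m xs r → ∃[ x ] x ∈ xs × + x ≡ r [mod m ]
  count-positive⁻ xs {r} pos = witness (filter (λ x → ≡[mod m ]? x r) (map +_ xs)) (λ p → p) pos
    where
    witness : ∀ ys → (∀ {y} → y ∈ ys → y ∈ filter (λ x → ≡[mod m ]? x r) (map +_ xs)) → 0 < length ys →
              ∃[ x ] x ∈ xs × + x ≡ r [mod m ]
    witness (y ∷ ys) sub _ with ∈-filter⁻ (λ x → ≡[mod m ]? x r) {xs = map +_ xs} (sub (here refl))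
    ... | y∈ , y≡r with ∈-map⁻ +_ y∈
    ... | x , x∈ , refl = x , x∈ , y≡r

  coprime-factorˡ : ∀ {a} d → Coprime (a * d) m → Coprime a m
  coprime-factorˡ d cop (i∣a , i∣m) = cop (∣m⇒∣m*n d i∣a , i∣m)

  coprime-factorʳ : ∀ a {d} → Coprime (a * d) m → Coprime d m
  coprime-factorʳ a cop (i∣d , i∣m) = cop (∣n⇒∣m*n a i∣d , i∣m)

  coprime-product : ∀ {a d} → Coprime a m → Coprime d m → Coprime (a * d) m
  coprime-product copᵃ copᵈ (i∣ad , i∣m) =
    copᵈ (coprime-divisor (λ (j∣i , j∣a) → copᵃ (j∣a , ∣-trans j∣i i∣m)) i∣ad , i∣m)

  coprime-divisorʳ : ∀ {d} → Coprime d m → ∀ z → + m ℤ.∣ z ℤ.* + d → + m ℤ.∣ z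
  coprime-divisorʳ {d} cop z m∣zd = ℤ.∣ᵤ⇒∣ (coprime-divisor (Coprimality.sym cop)
    (subst (m ∣_) (trans (ℤ.abs-* z (+ d)) (*-comm ℤ.∣ z ∣ d)) (ℤ.∣⇒∣ᵤ m∣zd)))

-- Gaps and the Apéry set of the multiplicity

-- The multiplicity is a = n + 1, and index i stands for a + (i + 1)d. The indices i < n give the
-- nonzero Apéry elements; i = n gives the endpoint a + ad of the telescoping.
apéryElement : (n d i : ℕ) → ℕ
apéryElement n d i = suc n + suc i * d

module _ (S : NumericalSemigroup) {n d : ℕ} (cop : Coprime (suc n) d) (1≤d : 1 ≤ d)
         (S≐A : Carrier S ≐ ⟨ ArithmeticSequence (suc n) d n ⟩) where

  private
    a = suc n
    S⊆A = proj₁ S≐A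
    A⊆S = proj₂ S≐A

  gap : ∀ {x} → ¬ Carrier S x → x ∈ gaps S
  gap = proj₁ (proj₂ (gaps-enumerates S))

  gap⁻ : ∀ {x} → x ∈ gaps S → ¬ Carrier S x
  gap⁻ = proj₂ (proj₂ (gaps-enumerates S))

  -- If (i + 1)d = ca + jd with c ≥ 1, then a divides (i + 1 - j)d, hence i + 1 - j, which is
  -- positive and smaller than a.
  multiple∉S : ∀ {i} → i < n → ¬ Carrier S (suc i * d)
  multiple∉S {i} i<n id∈S with ⟨arithmeticSequence⟩⇒ (S⊆A id∈S)
  ... | zero  , zero , _ , eq = <⇒≢ (≤-trans 1≤d (m≤m+n d (i * d))) (sym eq)
  ... | suc c , j    , _ , eq = <⇒≱ (s≤s i<n) (≤-trans a≤1+i∸j (m∸n≤m (suc i) j))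
    where
    j<1+i : j < suc i
    j<1+i = *-cancelʳ-< d j (suc i) (≤-trans (+-monoˡ-≤ (j * d) (s≤s z≤n)) (≤-reflexive (sym eq)))

    split : d * (suc i ∸ j) ≡ suc c * a
    split = begin
      d * (suc i ∸ j)                   ≡⟨ *-comm d (suc i ∸ j) ⟩
      (suc i ∸ j) * d                   ≡⟨ *-distribʳ-∸ d (suc i) j ⟩
      suc i * d ∸ j * d                 ≡⟨ cong (_∸ j * d) eq ⟩
      suc c * a + j * d ∸ j * d         ≡⟨ m+n∸n≡m (suc c * a) (j * d) ⟩
      suc c * a                         ∎
      where open ≡-Reasoning

    a≤1+i∸j : a ≤ suc i ∸ j
    a≤1+i∸j = ∣⇒≤ {{>-nonZero (m<n⇒0<n∸m j<1+i)}} (coprime-divisor cop (divides (suc c) split))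

  -- Write x = ca + jd with j ≤ cn. A copy of a can be split off within S unless c = 0, which gives
  -- 0, or c = 1 and j ≥ 1, which gives an Apéry element.
  descend : ∀ {x} → Carrier S x → x ≡ 0 ⊎ (∃[ i ] i < n × x ≡ apéryElement n d i) ⊎
    (∃[ y ] Carrier S y × x ≡ y + a)
  descend x∈S with ⟨arithmeticSequence⟩⇒ (S⊆A x∈S)
  ... | zero  , zero , _  , refl = inj₁ refl
  ... | suc c , j    , j≤ , refl with j ≤? c * n
  ...   | yes j≤cn =
    inj₂ (inj₂ (c * a + j * d , A⊆S (⟨arithmeticSequence⟩⇐ c j j≤cn) , regroup a (c * a) (j * d)))
    where
    regroup : ∀ a x y → a + x + y ≡ x + y + a
    regroup = solve-∀
  descend x∈S | suc zero , zero , _ , refl | no j≰ = contradiction z≤n j≰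
  descend x∈S | suc zero , suc i , j≤ , refl | no j≰ =
    inj₂ (inj₁ (i , subst (i <_) (+-identityʳ n) j≤ , cong (_+ suc i * d) (+-identityʳ a)))
  -- Here j > n, so a copies of d are traded for d copies of a, after which one a can be removed.
  descend x∈S | suc c@(suc _) , j , j≤ , refl | no j≰ =
    inj₂ (inj₂ ((c + d) * a + (j ∸ a) * d , A⊆S (⟨arithmeticSequence⟩⇐ (c + d) (j ∸ a) j∸a≤) , eq))
    where
    a≤j : a ≤ j
    a≤j = ≤-trans (s≤s (m≤m+n n _)) (≰⇒> j≰)

    j∸a≤ : j ∸ a ≤ (c + d) * n
    j∸a≤ = ≤-trans (m≤n+o⇒m∸n≤o j a (≤-trans j≤ (n≤1+n (n + c * n)))) (*-monoˡ-≤ n (m≤m+n c d))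

    regroup : ∀ a c d l → suc c * a + (a + l) * d ≡ (c + d) * a + l * d + a
    regroup = solve-∀

    eq : suc c * a + j * d ≡ (c + d) * a + (j ∸ a) * d + a
    eq = trans (cong (λ k → suc c * a + k * d) (sym (m+[n∸m]≡n a≤j))) (regroup a c d (j ∸ a))

  -- Both lists are free of duplicates and list the positive x with x - a outside S; having the same
  -- members, they are permutations of each other.
  apéry-↭ : map (_+ a) (gaps S) ++ map suc (upTo n) ↭ gaps S ++ map (apéryElement n d) (upTo n)
  apéry-↭ = ∼bag⇒↭ (unique∧set⇒bag unique-lhs unique-rhs (mk⇔ to from))
    where
    unique-gaps : Unique (gaps S)
    unique-gaps = proj₁ (gaps-enumerates S)

    unique-lhs : Unique (map (_+ a) (gaps S) ++ map suc (upTo n))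
    unique-lhs =
      Unique.++⁺ (Unique.map⁺ (+-cancelʳ-≡ a _ _) unique-gaps) (Unique.map⁺ suc-injective (Unique.upTo⁺ n))
        disjoint
      where
      disjoint : ∀ {x} → ¬ (x ∈ map (_+ a) (gaps S) × x ∈ map suc (upTo n))
      disjoint (x∈ , x∈′) with ∈-map⁻ (_+ a) x∈ | ∈-map⁻ suc x∈′
      ... | h , _ , refl | i , i∈ , eq = <⇒≱ (s≤s (∈-upTo⁻ i∈)) (subst (a ≤_) eq (m≤n+m a h))

    apéry∈S : ∀ {i} → i < n → Carrier S (apéryElement n d i)
    apéry∈S {i} i<n = A⊆S (generator∈⟨⟩ (suc i , i<n , refl))

    unique-rhs : Unique (gaps S ++ map (apéryElement n d) (upTo n))
    unique-rhs = Unique.++⁺ unique-gaps (Unique.map⁺ injective (Unique.upTo⁺ n)) disjoint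
      where
      injective : ∀ {i j} → apéryElement n d i ≡ apéryElement n d j → i ≡ j
      injective {i} {j} eq =
        suc-injective (*-cancelʳ-≡ (suc i) (suc j) d {{>-nonZero 1≤d}} (+-cancelˡ-≡ a _ _ eq))

      disjoint : ∀ {x} → ¬ (x ∈ gaps S × x ∈ map (apéryElement n d) (upTo n))
      disjoint (x∈ , x∈′) with ∈-map⁻ (apéryElement n d) x∈′
      ... | i , i∈ , refl = gap⁻ x∈ (apéry∈S (∈-upTo⁻ i∈))

    gap-or-apéry : ∀ {x} → x ≢ 0 → (∀ {y} → Carrier S y → x ≢ y + a) →
                   x ∈ gaps S ++ map (apéryElement n d) (upTo n)
    -- Membership in a list of numbers is decidable, so x may be assumed to be unlisted, and the
    -- case x ∈ S is refuted by `descend`.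
    gap-or-apéry {x} x≢0 x-a∉S = decidable-stable (x ∈? (gaps S ++ map (apéryElement n d) (upTo n))) λ x∉ →
      ∉gaps⇒¬¬∈ S (x∉ ∘ ∈-++⁺ˡ) λ x∈S → absurd x∉ (descend x∈S)
      where
      absurd : x ∉ gaps S ++ map (apéryElement n d) (upTo n) →
               ¬ (x ≡ 0 ⊎ (∃[ i ] i < n × x ≡ apéryElement n d i) ⊎ (∃[ y ] Carrier S y × x ≡ y + a))
      absurd x∉ (inj₁ x≡0)                     = x≢0 x≡0
      absurd x∉ (inj₂ (inj₁ (i , i<n , refl))) =
        x∉ (∈-++⁺ʳ (gaps S) (∈-map⁺ (apéryElement n d) (∈-upTo⁺ i<n)))
      absurd x∉ (inj₂ (inj₂ (y , y∈S , x≡)))   = x-a∉S y∈S x≡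

    to : ∀ {x} → x ∈ map (_+ a) (gaps S) ++ map suc (upTo n) → x ∈ gaps S ++ map (apéryElement n d) (upTo n)
    to x∈ with ∈-++⁻ (map (_+ a) (gaps S)) x∈
    ... | inj₁ x∈ˡ with ∈-map⁻ (_+ a) x∈ˡ
    ...   | h , h∈ , refl = gap-or-apéry (λ eq → 1+n≢0 (m+n≡0⇒n≡0 h eq))
                              λ y∈S eq → gap⁻ h∈ (subst (Carrier S) (sym (+-cancelʳ-≡ a _ _ eq)) y∈S)
    to x∈ | inj₂ x∈ʳ with ∈-map⁻ suc x∈ʳ
    ...   | i , i∈ , refl = gap-or-apéry (λ ())
                              λ {y} _ eq → <⇒≱ (s≤s (∈-upTo⁻ i∈)) (subst (a ≤_) (sym eq) (m≤n+m a y))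

    from : ∀ {x} → x ∈ gaps S ++ map (apéryElement n d) (upTo n) →
           x ∈ map (_+ a) (gaps S) ++ map suc (upTo n)
    from x∈ with ∈-++⁻ (gaps S) x∈
    from {zero}  x∈ | inj₁ x∈ˡ = contradiction (0-closed S) (gap⁻ x∈ˡ)
    -- A gap x ≥ a is the translate of x - a, again a gap because S is closed under adding a; a gap
    -- below a is one of 1, ..., n.
    from {suc x} x∈ | inj₁ x∈ˡ with a ≤? suc x
    ... | yes a≤x = ∈-++⁺ˡ (subst (_∈ map (_+ a) (gaps S)) (m∸n+n≡m a≤x) (∈-map⁺ (_+ a) (gap λ x-a∈S →
                      gap⁻ x∈ˡ (subst (Carrier S) (m∸n+n≡m a≤x)
                        (+-closed S x-a∈S (A⊆S a∈⟨arithmeticSequence⟩))))))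
    ... | no  a≰x = ∈-++⁺ʳ (map (_+ a) (gaps S)) (∈-map⁺ suc (∈-upTo⁺ (s≤s⁻¹ (≰⇒> a≰x))))
    from x∈ | inj₂ x∈ʳ with ∈-map⁻ (apéryElement n d) x∈ʳ
    ...   | i , i∈ , refl = ∈-++⁺ˡ (subst (_∈ map (_+ a) (gaps S)) (+-comm (suc i * d) a)
                              (∈-map⁺ (_+ a) (gap (multiple∉S (∈-upTo⁻ i∈)))))

  module _ {m : ℕ} where

    count-apéry : ∀ r → count m (gaps S) (r ℤ.- + a) + count m (map suc (upTo n)) r ≡
                        count m (gaps S) r + count m (map (apéryElement n d) (upTo n)) r
    count-apéry r = begin
      count m (gaps S) (r ℤ.- + a) + count m (map suc (upTo n)) r    ≡⟨ cong₂ _+_ shift refl ⟨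
      count m (map (_+ a) (gaps S)) r + count m (map suc (upTo n)) r ≡⟨ count-++ (map (_+ a) (gaps S)) _ r ⟨
      count m (map (_+ a) (gaps S) ++ map suc (upTo n)) r            ≡⟨ count-↭ apéry-↭ r ⟩
      count m (gaps S ++ map (apéryElement n d) (upTo n)) r          ≡⟨ count-++ (gaps S) _ r ⟩
      count m (gaps S) r + count m (map (apéryElement n d) (upTo n)) r ∎
      where
      open ≡-Reasoning
      eq : ∀ x a r → x ℤ.+ a ℤ.- r ≡ x ℤ.- (r ℤ.- a)
      eq = ℤSolver.solve-∀
      shift : count m (map (_+ a) (gaps S)) r ≡ count m (gaps S) (r ℤ.- + a)
      shift = trans (count-map-shift {g = λ x → x} (λ x → eq (+ x) (+ a) r) (gaps S))
                    (cong (λ xs → count m xs (r ℤ.- + a)) (map-id (gaps S)))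

    -- Translation by d embeds the gaps divisible by m into those congruent to d, and
    -- misses d itself, when a and m have a common factor.
    equidistributed⇒coprime-multiplicity : Equidistributed m (map +_ (gaps S)) → Coprime a m
    equidistributed⇒coprime-multiplicity equi = gcd≡1⇒coprime (decidable-stable (gcd a m ≟ 1) λ g≢1 →
      <⇒≢ (≤-trans (≤-reflexive (cong suc (sym (length-map (ℤ._+ + d) gaps₀))))
                   (unique-⊆⇒length≤ unique-shifted (shifted⊆ g≢1)))
          (equi 0ℤ (+ d)))
      where
      gaps₀ = filter (λ x → ≡[mod m ]? x 0ℤ) (map +_ (gaps S))
      shifted = + d ∷ map (ℤ._+ + d) gaps₀

      from-gaps₀ : ∀ {x} → x ∈ map (ℤ._+ + d) gaps₀ → ∃[ h ] h ∈ gaps S × m ∣ h × x ≡ + (h + d)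
      from-gaps₀ x∈ with ∈-map⁻ (ℤ._+ + d) x∈
      ... | y , y∈₀ , refl with ∈-filter⁻ (λ x → ≡[mod m ]? x 0ℤ) {xs = map +_ (gaps S)} y∈₀
      ... | y∈ , y≡0 with ∈-map⁻ +_ y∈
      ... | h , h∈ , refl = h , h∈ , subst (m ∣_) (+-identityʳ h) (ℤ.∣⇒∣ᵤ y≡0) , refl

      unique-shifted : Unique shifted
      unique-shifted = All.tabulate d∉ ∷
        Unique.map⁺ (λ {x} {y} → ∙-cancelʳ (+ d) x y)
          (Unique.filter⁺ (λ x → ≡[mod m ]? x 0ℤ) (Unique.map⁺ ℤ.+-injective (proj₁ (gaps-enumerates S))))
        where
        d∉ : ∀ {x} → x ∈ map (ℤ._+ + d) gaps₀ → + d ≢ x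
        d∉ x∈ d≡x with from-gaps₀ x∈
        ... | h , h∈ , _ , refl =
          gap⁻ h∈ (subst (Carrier S) (sym (+-cancelʳ-≡ d h 0 (sym (ℤ.+-injective d≡x)))) (0-closed S))

      module _ (g≢1 : gcd a m ≢ 1) where
        -- A common factor rules out a = 1, so `multiple∉S` applies to d itself.
        0<n : 0 < n
        0<n = n≢0⇒n>0 λ n≡0 → g≢1 (∣1⇒≡1 (subst (λ k → gcd a m ∣ suc k) n≡0 (gcd[m,n]∣m a m)))

        -- Let h + d = ca + jd. If j = 0, then gcd(a, m) divides h and ca, hence d, against
        -- coprimality of a and d; if j ≥ 1, removing one d puts h in S.
        h+d∉S : ∀ {h} → m ∣ h → ¬ Carrier S h → ¬ Carrier S (h + d)
        h+d∉S {h} m∣h h∉S h+d∈S with ⟨arithmeticSequence⟩⇒ (S⊆A h+d∈S)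
        ... | c , zero  , _  , eq = g≢1 (cop (gcd[m,n]∣m a m ,
                ∣m+n∣m⇒∣n (subst (gcd a m ∣_) (trans (sym (+-identityʳ (c * a))) (sym eq))
                  (∣n⇒∣m*n c (gcd[m,n]∣m a m)))
                           (∣-trans (gcd[m,n]∣n a m) m∣h)))
        ... | c , suc j , j≤ , eq =
          h∉S (subst (Carrier S) (sym h≡) (A⊆S (⟨arithmeticSequence⟩⇐ c j (<⇒≤ j≤))))
          where
          regroup : ∀ x d y → x + (d + y) ≡ x + y + d
          regroup = solve-∀
          h≡ : h ≡ c * a + j * d
          h≡ = +-cancelʳ-≡ d _ _ (trans eq (regroup (c * a) d (j * d)))

        shifted⊆ : ∀ {x} → x ∈ shifted → x ∈ filter (λ x → ≡[mod m ]? x (+ d)) (map +_ (gaps S))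
        shifted⊆ (here refl) = ∈-filter⁺ (λ x → ≡[mod m ]? x (+ d))
          (∈-map⁺ +_ (subst (_∈ gaps S) (+-identityʳ d) (gap (multiple∉S 0<n)))) (mod-refl (+ d))
        shifted⊆ (there x∈) with from-gaps₀ x∈
        ... | h , h∈ , m∣h , refl =
          ∈-filter⁺ (λ x → ≡[mod m ]? x (+ d)) (∈-map⁺ +_ (gap (h+d∉S m∣h (gap⁻ h∈))))
          (∣-resp (eq (+ h) (+ d)) (ℤ.∣ᵤ⇒∣ m∣h))
          where
          eq : ∀ h d → h ≡ h ℤ.+ d ℤ.- d
          eq = ℤSolver.solve-∀

-- Comparing the two residue counts

SameResidueCounts : (m n d : ℕ) → Set
SameResidueCounts m n d = ∀ r → count m (map suc (upTo n)) r ≡ count m (map (apéryElement n d) (upTo n)) r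

module _ {m n d : ℕ} where

  private
    a = suc n

    interval : ℤ → ℕ
    interval = count m (map suc (upTo n))

    apéry : ℤ → ℕ
    apéry = count m (map (apéryElement n d) (upTo n))

    interval-step : ∀ r → count m (1 ∷ []) r + interval (r ℤ.- 1ℤ) ≡ interval r + count m (a ∷ []) r
    interval-step = count-progression suc 1 (λ i → +-comm 1 (suc i)) n

    apéry-step : ∀ r → count m (apéryElement n d 0 ∷ []) r + apéry (r ℤ.- + d) ≡
      apéry r + count m (apéryElement n d n ∷ []) r
    apéry-step = count-progression (apéryElement n d) d (λ i → regroup a d i) n
      where
      regroup : ∀ a d i → a + (d + (d + i * d)) ≡ a + (d + i * d) + d
      regroup = solve-∀

  -- The number n = a - 1 lies in the interval, so some a + (i + 1)d is congruent to it, and then m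
  -- divides 1 + (i + 1)d. For a = 1 the interval is empty and d = 1 by convention.
  sameResidueCounts⇒coprime-difference : (a ≡ 1 → d ≡ 1) → SameResidueCounts m n d → Coprime d m
  sameResidueCounts⇒coprime-difference a≡1⇒d≡1 same with n ≟ 0
  ... | yes refl = subst (λ k → Coprime k m) (sym (a≡1⇒d≡1 refl)) (1-coprimeTo m)
  ... | no  n≢0  = common-divisor m∣1+kd
    where
    n∈interval : n ∈ map suc (upTo n)
    n∈interval =
      subst (_∈ map suc (upTo n)) (suc-pred n {{≢-nonZero n≢0}})
        (∈-map⁺ suc (∈-upTo⁺ (≤-reflexive (suc-pred n {{≢-nonZero n≢0}}))))

    n∈apéry : ∃[ x ] x ∈ map (apéryElement n d) (upTo n) × + x ≡ + n [mod m ]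
    n∈apéry = count-positive⁻ _ (subst (0 <_) (same (+ n)) (count-positive⁺ n∈interval (mod-refl (+ n))))

    common-divisor : ∃[ k ] m ∣ suc (k * d) → Coprime d m
    common-divisor (k , m∣1+kd) {i} (i∣d , i∣m) =
      ∣1⇒≡1 (∣m+n∣m⇒∣n (subst (i ∣_) (+-comm 1 (k * d)) (∣-trans i∣m m∣1+kd)) (∣n⇒∣m*n k i∣d))

    m∣1+kd : ∃[ k ] m ∣ suc (k * d)
    m∣1+kd with n∈apéry
    ... | x , x∈ , x≡n with ∈-map⁻ (apéryElement n d) x∈
    ... | i , _ , refl = suc i , ℤ.∣⇒∣ᵤ (∣-resp (eq (+ n) (+ (suc i * d))) x≡n)
      where
      eq : ∀ n k → 1ℤ ℤ.+ n ℤ.+ k ℤ.- n ≡ 1ℤ ℤ.+ k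
      eq = ℤSolver.solve-∀

  -- With z marking residues, the two counts are Laurent polynomials modulo zᵐ − 1;
  -- clearing the denominators 1 − z and 1 − zᵈ of the two geometric sums gives
  -- z + z^(a+ad) + z^(a+d+1) = z^a + z^(d+1) + z^(a+ad+1), of which only the
  -- coefficient at z is needed: 1 is congruent to a, to d + 1 or to a + ad + 1.
  sameResidueCounts⇒ : Coprime a m → Coprime d m → SameResidueCounts m n d →
                       + a ≡ 1ℤ [mod m ] ⊎ + d ≡ -1ℤ [mod m ]
  sameResidueCounts⇒ copᵃ copᵈ same with ≡[mod m ]? (+ a) 1ℤ | ≡[mod m ]? (+ d) -1ℤ
  ... | yes a≡1 | _        = inj₁ a≡1
  ... | no  _   | yes d≡-1 = inj₂ d≡-1
  ... | no  a≢1 | no  d≢-1 = contradiction chain (n≮n (interval 0ℤ))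
    where
    -- If m divides d, which is coprime to it, then m = 1 and a ≡ 1 after all.
    1≢1-d : ¬ + 1 ≡ 1ℤ ℤ.- + d [mod m ]
    1≢1-d p = a≢1 (subst (λ k → + k ℤ.∣ + a ℤ.- 1ℤ) (sym m≡1) (ℤ.∣ᵤ⇒∣ (1∣ _)))
      where
      eq : ∀ d → 1ℤ ℤ.- (1ℤ ℤ.- d) ≡ d
      eq = ℤSolver.solve-∀
      m≡1 : m ≡ 1
      m≡1 = copᵈ (ℤ.∣⇒∣ᵤ (∣-resp (eq (+ d)) p) , ∣-refl)

    -- Since a + ad = a(d + 1) and a is coprime to m, m would divide d + 1.
    a+ad≢0 : ¬ + apéryElement n d n ≡ 0ℤ [mod m ]
    a+ad≢0 p = d≢-1 (subst (λ k → + m ℤ.∣ + k) (+-comm 1 d) (ℤ.∣ᵤ⇒∣ (coprime-divisor (Coprimality.sym copᵃ)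
      (subst (m ∣_) (eq a d) (ℤ.∣⇒∣ᵤ p)))))
      where
      eq : ∀ a d → a + a * d + 0 ≡ a * suc d
      eq = solve-∀

    a-d-shift : count m (apéryElement n d 0 ∷ []) 1ℤ ≡ count m (a ∷ []) (1ℤ ℤ.- + d)
    a-d-shift = count-map-shift {m} {λ _ → apéryElement n d 0} {g = λ _ → a} {1ℤ} {1ℤ ℤ.- + d} (λ _ → trans
      (cong (λ k → + (a + k) ℤ.- 1ℤ) (+-identityʳ d)) (eq (+ a) (+ d))) (0 ∷ [])
      where
      eq : ∀ a d → a ℤ.+ d ℤ.- 1ℤ ≡ a ℤ.- (1ℤ ℤ.- d)
      eq = ℤSolver.solve-∀

    -- Telescoping at the residues 1, 1, 1 - d and 0, alternately for the interval and the Apéry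
    -- progression, leads back to the start. The endpoint 1 at residue 1 adds one; the endpoints
    -- that could offset it vanish by the three non-congruences.
    chain : interval 0ℤ < interval 0ℤ
    chain = begin-strict
      interval 0ℤ                                                    <⟨ n<1+n _ ⟩
      1 + interval 0ℤ
        ≡⟨ cong (_+ interval 0ℤ) (count-singleton-yes {m} {1} {1ℤ} (mod-refl 1ℤ)) ⟨
      count m (1 ∷ []) 1ℤ + interval 0ℤ                              ≡⟨ interval-step 1ℤ ⟩
      interval 1ℤ + count m (a ∷ []) 1ℤ
        ≡⟨ cong₂ _+_ (same 1ℤ) (count-singleton-no {m} {a} {1ℤ} a≢1) ⟩
      apéry 1ℤ + 0                                                   ≤⟨ +-monoʳ-≤ (apéry 1ℤ) z≤n ⟩
      apéry 1ℤ + count m (apéryElement n d n ∷ []) 1ℤ                ≡⟨ apéry-step 1ℤ ⟨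
      count m (apéryElement n d 0 ∷ []) 1ℤ + apéry (1ℤ ℤ.- + d)
        ≡⟨ cong₂ _+_ a-d-shift (sym (same (1ℤ ℤ.- + d))) ⟩
      count m (a ∷ []) (1ℤ ℤ.- + d) + interval (1ℤ ℤ.- + d)
        ≡⟨ +-comm (count m (a ∷ []) (1ℤ ℤ.- + d)) _ ⟩
      interval (1ℤ ℤ.- + d) + count m (a ∷ []) (1ℤ ℤ.- + d)          ≡⟨ interval-step (1ℤ ℤ.- + d) ⟨
      count m (1 ∷ []) (1ℤ ℤ.- + d) + interval (1ℤ ℤ.- + d ℤ.- 1ℤ)
        ≡⟨ cong₂ _+_ (count-singleton-no {m} {1} {1ℤ ℤ.- + d} 1≢1-d)
          (trans (cong interval (eq (+ d))) (same (0ℤ ℤ.- + d))) ⟩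
      apéry (0ℤ ℤ.- + d)
        ≤⟨ m≤n+m _ (count m (apéryElement n d 0 ∷ []) 0ℤ) ⟩
      count m (apéryElement n d 0 ∷ []) 0ℤ + apéry (0ℤ ℤ.- + d)      ≡⟨ apéry-step 0ℤ ⟩
      apéry 0ℤ + count m (apéryElement n d n ∷ []) 0ℤ
        ≡⟨ cong₂ _+_ (sym (same 0ℤ)) (count-singleton-no {m} {apéryElement n d n} {0ℤ} a+ad≢0) ⟩
      interval 0ℤ + 0                                                ≡⟨ +-identityʳ _ ⟩
      interval 0ℤ                                                    ∎
      where
      open ≤-Reasoning
      eq : ∀ d → 1ℤ ℤ.- d ℤ.- 1ℤ ≡ 0ℤ ℤ.- d
      eq = ℤSolver.solve-∀

  -- Multiplication by d permutes the residues modulo m, over which 1, …, a − 1 are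
  -- equidistributed.
  sameResidueCounts⇐₁ : .{{_ : NonZero m}} → Coprime d m → + a ≡ 1ℤ [mod m ] → SameResidueCounts m n d
  sameResidueCounts⇐₁ cop a≡1 r = counts (coprime⇒multiple cop (r ℤ.- + a))
    where
    endpoints : ∀ r → count m (1 ∷ []) r ≡ count m (a ∷ []) r
    endpoints r = count-map-cong {f = λ _ → 1} {g = λ _ → a}
      (λ _ → mod-trans (+ a) 1ℤ r a≡1) (λ _ → mod-trans 1ℤ (+ a) r (mod-sym (+ a) 1ℤ a≡1)) (0 ∷ [])

    -- As 1 ≡ a, the endpoint terms of the telescoping cancel, leaving invariance under translation
    -- by 1.
    interval-equidistributed : Equidistributed m (map +_ (map suc (upTo n)))
    interval-equidistributed = shift-invariant⇒constant (map +_ (map suc (upTo n))) (1-coprimeTo m) λ r →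
      +-cancelˡ-≡ (count m (1 ∷ []) r) _ _ (trans (interval-step r)
        (trans (+-comm (interval r) _) (cong (_+ interval r) (sym (endpoints r)))))

    -- Since a + id - r = (i - t)d + (td - (r - a)) and d is coprime to m, a + id ≡ r exactly when i
    -- ≡ t.
    counts : ∃[ t ] + t ℤ.* + d ≡ r ℤ.- + a [mod m ] → interval r ≡ apéry r
    counts (t , td≡r-a) = trans (interval-equidistributed r (+ t)) (count-map-cong to from (upTo n))
      where
      eq : ∀ a d r t k → (k ℤ.- t) ℤ.* d ℤ.+ (t ℤ.* d ℤ.- (r ℤ.- a)) ≡ a ℤ.+ k ℤ.* d ℤ.- r
      eq = ℤSolver.solve-∀

      eq′ : ∀ i → (+ suc i ℤ.- + t) ℤ.* + d ℤ.+ (+ t ℤ.* + d ℤ.- (r ℤ.- + a)) ≡ + apéryElement n d i ℤ.- r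
      eq′ i =
        trans (eq (+ a) (+ d) r (+ t) (+ suc i)) (cong (λ k → + a ℤ.+ k ℤ.- r) (sym (ℤ.pos-* (suc i) d)))

      to : ∀ i → + suc i ≡ + t [mod m ] → + apéryElement n d i ≡ r [mod m ]
      to i p = ∣-resp (eq′ i) (ℤ.∣m∣n⇒∣m+n (ℤ.∣m⇒∣m*n (+ d) p) td≡r-a)

      from : ∀ i → + apéryElement n d i ≡ r [mod m ] → + suc i ≡ + t [mod m ]
      from i p = coprime-divisorʳ cop (+ suc i ℤ.- + t) (ℤ.∣m+n∣n⇒∣m (∣-resp (sym (eq′ i)) p) td≡r-a)

  -- With d ≡ -1 the element a + (i + 1)d is congruent to n - i, so the progression is the interval
  -- reversed.
  sameResidueCounts⇐₂ : + d ≡ -1ℤ [mod m ] → SameResidueCounts m n d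
  sameResidueCounts⇐₂ d≡-1 r = sym (count-reverse (apéryElement n d) n reversed r)
    where
    eq : ∀ n k d → k ℤ.* (d ℤ.+ 1ℤ) ≡ 1ℤ ℤ.+ n ℤ.+ k ℤ.* d ℤ.+ (k ℤ.- 1ℤ) ℤ.- n
    eq = ℤSolver.solve-∀

    reversed : ∀ i → + (apéryElement n d i + i) ≡ + n [mod m ]
    reversed i =
      ∣-resp (trans (eq (+ n) (+ suc i) (+ d))
        (cong (λ k → + a ℤ.+ k ℤ.+ + i ℤ.- + n) (sym (ℤ.pos-* (suc i) d))))
      (ℤ.∣n⇒∣m*n (+ suc i) d≡-1)

-- The equivalence for a given presentation

equidistributed⇔ : ∀ S {m n d} .{{_ : NonZero m}} → IsPresentedBy S (suc n) d →
  Equidistributed m (map +_ (gaps S)) ⇔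
  (gcd (suc n * d) m ≡ 1 × (+ suc n ≡ 1ℤ [mod m ] ⊎ + d ≡ -1ℤ [mod m ]))
equidistributed⇔ S {m} {n} {d} (_ , 1≤d , gcd≡1 , a≡1⇒d≡1 , S≐A) = mk⇔ to from
  where
  a = suc n

  cop : Coprime a d
  cop = gcd≡1⇒coprime gcd≡1

  to : Equidistributed m (map +_ (gaps S)) → gcd (a * d) m ≡ 1 × (+ a ≡ 1ℤ [mod m ] ⊎ + d ≡ -1ℤ [mod m ])
  to equi = coprime⇒gcd≡1 (coprime-product copᵃ copᵈ) , sameResidueCounts⇒ {m} {n} {d} copᵃ copᵈ same
    where
    same : SameResidueCounts m n d
    -- Equidistribution makes the two gap counts in `count-apéry` equal, so they cancel.
    same r = +-cancelˡ-≡ (count m (gaps S) r) _ _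
      (trans (cong (_+ count m (map suc (upTo n)) r) (equi r (r ℤ.- + a))) (count-apéry S cop 1≤d S≐A r))

    copᵃ : Coprime a m
    copᵃ = equidistributed⇒coprime-multiplicity S cop 1≤d S≐A equi

    copᵈ : Coprime d m
    copᵈ = sameResidueCounts⇒coprime-difference {m} {n} {d} a≡1⇒d≡1 same

  from : gcd (a * d) m ≡ 1 × (+ a ≡ 1ℤ [mod m ] ⊎ + d ≡ -1ℤ [mod m ]) → Equidistributed m (map +_ (gaps S))
  -- Conversely, equal progression counts cancel and leave the gap count invariant under translation
  -- by a, which is coprime to m.
  from (gcd-ad≡1 , cases) = shift-invariant⇒constant (map +_ (gaps S)) (coprime-factorˡ d cop-ad) λ r →
    +-cancelʳ-≡ (count m (map suc (upTo n)) r) _ _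
      (trans (count-apéry S cop 1≤d S≐A r) (cong (λ k → count m (gaps S) r + k) (sym (same r))))
    where
    cop-ad : Coprime (a * d) m
    cop-ad = gcd≡1⇒coprime gcd-ad≡1

    same : SameResidueCounts m n d
    same =
      Sum.[ sameResidueCounts⇐₁ {m} {n} {d} (coprime-factorʳ a cop-ad) , sameResidueCounts⇐₂ {m} {n} {d} ]
        cases

corollary5p10 : (S : NumericalSemigroup) →
    HasMaximalEmbeddingDimension S →
    IsGeneratedByArithmeticSequence S →
    (m : ℕ) → 1 ≤ m →
    (∃[ a ] ∃[ d ] IsPresentedBy S a d) ×
    (∀ a d → IsPresentedBy S a d →
    (Equidistributed m (map +_ (gaps S)) ⇔
    (gcd (a * d) m ≡ 1 ×
    ((+ a) ≡ 1ℤ [mod m ] ⊎ (+ d) ≡ -1ℤ [mod m ]))))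
corollary5p10 S maximal arithmetic m 1≤m =
  presentation-exists S maximal arithmetic ,
  -- A presentation includes 1 ≤ a, so the case a = 0 is empty.
  λ { (suc n) d presented → equidistributed⇔ S {{>-nonZero 1≤m}} presented }
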